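{- Let $p\ge 7$ be a prime and $k=(p-1)/2$. Then $\mathsf{BO}(k,\mathbb{Z}/p\mathbb{Z})=k+1$ if the multiplicative order of $2$ modulo $p$ is odd, and $\mathsf{BO}(k,\mathbb{Z}/p\mathbb{Z})=k+2$ if the multiplicative order of $2$ modulo $p$ is even.
   Context: For a positive integer $k$, a set $\{g_1,\dots,g_k\}$ of $k$ distinct elements of a finite abelian group $G$ (written additively) is called $k$-barycentric if $\sum_{i=1}^k g_i = k\,g_j$ for some $1\le j\le k$. The $k$-th barycentric Olson constant $\mathsf{BO}(k,G)$ is the smallest integer $\ell$ such that every subset $A\subseteq G$ with $|A|\ge \ell$ contains a $k$-barycentric subset (so that always $\mathsf{BO}(k,G)\le |G|+1$). The multiplicative order of $2$ modulo $p$ is the least positive integer $t$ with $2^t\equiv 1 \pmod p$. -}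

module Defs where

open import Algebra.Bundles using (AbelianGroup)
open import Algebra.Structures using (IsAbelianGroup)
open import Data.Fin.Base using (Fin; toℕ)
open import Data.Fin.Properties using (toℕ-fromℕ<; toℕ-injective; toℕ<n)
open import Data.List.Base using (List; foldr; length)
open import Data.Nat.Base hiding (_⊔_)
open import Data.Nat.DivMod
open import Data.Nat.Properties using (+-assoc; +-comm; m∸n+n≡m; <⇒≤)
open import Data.Product.Base using (_×_; _,_; ∃-syntax)
open import Level using (0ℓ; _⊔_)
open import Relation.Binary.PropositionalEquality hiding (setoid)

-- A finite subset of G is a list of pairwise distinct elements, its
-- cardinality being the length of the list.  For finite G these are all the
-- subsets of G.
module Barycentric {c ℓ} (G : AbelianGroup c ℓ) where

  open AbelianGroup G using (Carrier; _≈_; _∙_; ε; setoid; rawMonoid)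
  open import Algebra.Definitions.RawMonoid rawMonoid public
    using () renaming (_×_ to _·_)
  open import Data.List.Membership.Setoid setoid using (_∈_)
  open import Data.List.Relation.Binary.Subset.Setoid setoid using (_⊆_)
  open import Data.List.Relation.Unary.Unique.Setoid setoid using (Unique)

  sum : List Carrier → Carrier
  sum = foldr _∙_ ε

  IsBarycentric : ℕ → List Carrier → Set (c ⊔ ℓ)
  IsBarycentric k B =
    Unique B × length B ≡ k × (∃[ g ] (g ∈ B × sum B ≈ k · g))

  ForcesBarycentric : ℕ → ℕ → Set (c ⊔ ℓ)
  ForcesBarycentric k l =
    ∀ (A : List Carrier) → Unique A → length A ≥ l →
    ∃[ B ] (B ⊆ A × IsBarycentric k B)

  -- IsBO k l  says  BO(k,G) = l.
  IsBO : ℕ → ℕ → Set (c ⊔ ℓ)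
  IsBO k l = ForcesBarycentric k l × (∀ m → ForcesBarycentric k m → l ≤ m)

open Barycentric public using (IsBO)

IsMultiplicativeOrder : (a n : ℕ) → .{{NonZero n}} → ℕ → Set
IsMultiplicativeOrder a n t =
  IsExponent t × (∀ s → IsExponent s → t ≤ s)
  where
  IsExponent : ℕ → Set
  IsExponent s = 0 < s × (a ^ s) % n ≡ 1 % n

module Modular (n : ℕ) .{{_ : NonZero n}} where

  infixl 6 _⊕_

  _⊕_ : Fin n → Fin n → Fin n
  i ⊕ j = (toℕ i + toℕ j) mod n

  0# : Fin n
  0# = 0 mod n

  ⊖_ : Fin n → Fin n
  ⊖ i = (n ∸ toℕ i) mod n

  toℕ-mod : ∀ m → toℕ (m mod n) ≡ m % n
  toℕ-mod m = toℕ-fromℕ< (m%n<n m n)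

  toℕ-% : ∀ i → toℕ i % n ≡ toℕ i
  toℕ-% i = m<n⇒m%n≡m (toℕ<n i)

  %-+ˡ : ∀ a b → (a % n + b) % n ≡ (a + b) % n
  %-+ˡ a b = begin
    (a % n + b) % n          ≡⟨ %-distribˡ-+ (a % n) b n ⟩
    (a % n % n + b % n) % n  ≡⟨ cong (λ x → (x + b % n) % n) (m%n%n≡m%n a n) ⟩
    (a % n + b % n) % n      ≡⟨ %-distribˡ-+ a b n ⟨
    (a + b) % n              ∎
    where open ≡-Reasoning

  ⊕-comm : ∀ i j → i ⊕ j ≡ j ⊕ i
  ⊕-comm i j = cong (_mod n) (+-comm (toℕ i) (toℕ j))

  toℕ-⊕ : ∀ i j → toℕ (i ⊕ j) ≡ (toℕ i + toℕ j) % n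
  toℕ-⊕ i j = toℕ-mod (toℕ i + toℕ j)

  toℕ-⊕⊕ : ∀ i j k → toℕ ((i ⊕ j) ⊕ k) ≡ (toℕ i + toℕ j + toℕ k) % n
  toℕ-⊕⊕ i j k = begin
    toℕ ((i ⊕ j) ⊕ k)                    ≡⟨ toℕ-⊕ (i ⊕ j) k ⟩
    (toℕ (i ⊕ j) + toℕ k) % n            ≡⟨ cong (λ x → (x + toℕ k) % n) (toℕ-⊕ i j) ⟩
    ((toℕ i + toℕ j) % n + toℕ k) % n    ≡⟨ %-+ˡ (toℕ i + toℕ j) (toℕ k) ⟩
    (toℕ i + toℕ j + toℕ k) % n          ∎
    where open ≡-Reasoning

  ⊕-assoc : ∀ i j k → (i ⊕ j) ⊕ k ≡ i ⊕ (j ⊕ k)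
  ⊕-assoc i j k = toℕ-injective (begin
    toℕ ((i ⊕ j) ⊕ k)              ≡⟨ toℕ-⊕⊕ i j k ⟩
    (toℕ i + toℕ j + toℕ k) % n    ≡⟨ cong (_% n) (+-assoc (toℕ i) (toℕ j) (toℕ k)) ⟩
    (toℕ i + (toℕ j + toℕ k)) % n  ≡⟨ cong (_% n) (+-comm (toℕ i) (toℕ j + toℕ k)) ⟩
    (toℕ j + toℕ k + toℕ i) % n    ≡⟨ toℕ-⊕⊕ j k i ⟨
    toℕ ((j ⊕ k) ⊕ i)              ≡⟨ cong toℕ (⊕-comm (j ⊕ k) i) ⟩
    toℕ (i ⊕ (j ⊕ k))              ∎)
    where open ≡-Reasoning

  ⊕-identityˡ : ∀ i → 0# ⊕ i ≡ i
  ⊕-identityˡ i = toℕ-injective (begin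
    toℕ (0# ⊕ i)             ≡⟨ toℕ-⊕ 0# i ⟩
    (toℕ 0# + toℕ i) % n     ≡⟨ cong (λ x → (x + toℕ i) % n) (toℕ-mod 0) ⟩
    (0 % n + toℕ i) % n      ≡⟨ %-+ˡ 0 (toℕ i) ⟩
    toℕ i % n                ≡⟨ toℕ-% i ⟩
    toℕ i                    ∎)
    where open ≡-Reasoning

  ⊖-inverseˡ : ∀ i → (⊖ i) ⊕ i ≡ 0#
  ⊖-inverseˡ i = toℕ-injective (begin
    toℕ ((⊖ i) ⊕ i)              ≡⟨ toℕ-⊕ (⊖ i) i ⟩
    (toℕ (⊖ i) + toℕ i) % n      ≡⟨ cong (λ x → (x + toℕ i) % n) (toℕ-mod (n ∸ toℕ i)) ⟩
    ((n ∸ toℕ i) % n + toℕ i) % n  ≡⟨ %-+ˡ (n ∸ toℕ i) (toℕ i) ⟩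
    (n ∸ toℕ i + toℕ i) % n      ≡⟨ cong (_% n) (m∸n+n≡m (<⇒≤ (toℕ<n i))) ⟩
    n % n                        ≡⟨ n%n≡0 n ⟩
    0                            ≡⟨ m<n⇒m%n≡m (>-nonZero⁻¹ n) ⟨
    0 % n                        ≡⟨ toℕ-mod 0 ⟨
    toℕ 0#                       ∎)
    where open ≡-Reasoning

  isAbelianGroup : IsAbelianGroup _≡_ _⊕_ 0# ⊖_
  isAbelianGroup = record
    { isGroup = record
      { isMonoid = record
        { isSemigroup = record
          { isMagma = record { isEquivalence = isEquivalence ; ∙-cong = cong₂ _⊕_ }
          ; assoc = ⊕-assoc
          }
        ; identity = ⊕-identityˡ , λ i → trans (⊕-comm i 0#) (⊕-identityˡ i)
        }
      ; inverse = ⊖-inverseˡ , λ i → trans (⊕-comm i (⊖ i)) (⊖-inverseˡ i)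
      ; ⁻¹-cong = cong ⊖_
      }
    ; comm = ⊕-comm
    }

ℤ/ : (n : ℕ) → .{{NonZero n}} → AbelianGroup 0ℓ 0ℓ
ℤ/ n = record { isAbelianGroup = Modular.isAbelianGroup n }

{-# OPTIONS --safe #-}
module Submission where

open import Defs
open import Data.Nat.Base using (ℕ; NonZero; _+_; _∸_; _≤_; _/_; parity)
open import Data.Nat.Primality using (Prime)
open import Data.Parity.Base using (0ℙ; 1ℙ)
open import Data.Product.Base using (_×_)
open import Relation.Binary.PropositionalEquality using (_≡_)

open import Algebra.Bundles using (AbelianGroup)
open import Data.Empty using (⊥)
open import Data.Fin.Base using (Fin; toℕ; fromℕ<)
import Data.Fin.Properties as Fin
open import Data.Integer.Base as ℤ using (ℤ; +_)
import Data.Integer.DivMod as ℤ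
import Data.Integer.Divisibility.Signed as ℤ∣
open ℤ∣ using (divides) renaming (_∣_ to _∣ℤ_)
import Data.Integer.Properties as ℤₚ
open import Data.Integer.Tactic.RingSolver using (solve-∀)
open import Data.List.Base
  using (List; []; _∷_; _++_; length; map; take; filter; upTo; allFin; applyDownFrom)
open import Data.List.Membership.Propositional using (_∈_; _∉_; find; lose)
open import Data.List.Membership.Propositional.Properties
  using (∈-∃++; ∈-map⁻; ∈-++⁻; ∈-++⁺ˡ; ∈-applyDownFrom⁻; ∈-upTo⁺; ∈-allFin; ∈-filter⁺; ∈-filter⁻)
open import Data.List.Properties using
  (length-++; ++-identityʳ; length-map; length-take; take++drop≡id; length-applyDownFrom; length-tabulate)
open import Data.List.Relation.Binary.Permutation.Propositional
  using (_↭_; ↭-sym; ↭-trans; ↭-reflexive; ↭-refl; prep; ↭⇒↭ₛ)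
open import Data.List.Relation.Binary.Permutation.Propositional.Properties
  using (∈-resp-↭; ↭-length; shift)
import Data.List.Relation.Binary.Permutation.Setoid.Properties as ↭ₛ
open import Data.List.Relation.Binary.Subset.Propositional using (_⊆_)
import Data.List.Relation.Unary.All as All
open import Data.List.Relation.Unary.All.Properties using (¬Any⇒All¬; All¬⇒¬Any)
open import Data.List.Relation.Unary.AllPairs using ([]; _∷_; tail)
open import Data.List.Relation.Unary.Any using (here; there; any?)
open import Data.List.Relation.Unary.Unique.Propositional using (Unique)
import Data.List.Relation.Unary.Unique.Propositional.Properties as Unique
import Data.Nat.Base as ℕ
import Data.Nat.Divisibility as ℕ∣
import Data.Nat.DivMod as ℕ
open import Data.Nat.Primality using (euclidsLemma; prime⇒irreducible)
import Data.Nat.Properties as ℕₚ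
open import Data.List.Extrema ℕₚ.≤-totalOrder using (argmin; f[argmin]≤f[xs])
open import Data.Parity.Base as ℙ using (Parity; _⁻¹)
import Data.Parity.Properties as ℙ
open import Data.Product.Base using (∃-syntax; _,_; proj₁; proj₂)
open import Data.Sum.Base as Sum using (_⊎_; inj₁; inj₂; fromInj₁)
open import Function.Base using (_∘_; id)
open import Relation.Binary.PropositionalEquality
  using (_≢_; refl; sym; trans; cong; cong₂; subst; setoid; module ≡-Reasoning)
open import Relation.Nullary using (¬_; yes; no; ¬?; _×-dec_; contradiction)
open import Relation.Nullary.Decidable using (True; toWitness; decidable-stable)

-- With p = 2k + 1, a k-set B is barycentric iff -2 ΣB ∈ B.  Hence a (k+1)-set
-- A with sum S contains no barycentric k-set iff, on moving 2S to the origin,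
-- no nonzero a ∈ A has 2a ∈ A.  Counting then shows that 0 ∈ A and that A ∖ {0}
-- and its double partition the nonzero residues, so that A ∖ {0} is stable
-- under x ↦ 4x and swapped with its complement by x ↦ 2x.  If 2 has odd order
-- this is absurd.  If 2 has even order, such an A with S = 0 is obtained from
-- the residues that reach the least element of their ⟨2⟩-orbit after an even
-- number of doublings.  A (k+2)-set all of whose (k+1)-subsets are of this kind
-- would contain points of an arithmetic progression violating double-freeness.
-- Finally the k nonzero squares have sum 0 and do not form a barycentric set.

-- Duplicate-free lists as finite sets.

module _ {a} {A : Set a} where

  Unique-resp-↭ : ∀ {xs ys : List A} → xs ↭ ys → Unique xs → Unique ys
  Unique-resp-↭ = ↭ₛ.Unique-resp-↭ (setoid A) ∘ ↭⇒↭ₛ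

  ∈⇒↭ : ∀ {x : A} {xs} → x ∈ xs → ∃[ ys ] xs ↭ x ∷ ys
  ∈⇒↭ x∈xs with ys , zs , refl ← ∈-∃++ x∈xs = ys ++ zs , shift _ ys zs

  head∉tail : ∀ {x : A} {xs} → Unique (x ∷ xs) → x ∉ xs
  head∉tail (x≢xs ∷ _) = All¬⇒¬Any x≢xs

  ∉∧∈⇒≢ : ∀ {x y : A} {xs} → x ∉ xs → y ∈ xs → y ≢ x
  ∉∧∈⇒≢ x∉xs y∈xs refl = x∉xs y∈xs

  ∈-tail : ∀ {x y : A} {xs} → y ∈ x ∷ xs → y ≢ x → y ∈ xs
  ∈-tail (here y≡x)   y≢x = contradiction y≡x y≢x
  ∈-tail (there y∈xs) _   = y∈xs

  Unique-⊆⇒↭ : ∀ {xs ys : List A} → Unique ys → ys ⊆ xs → ∃[ zs ] xs ↭ ys ++ zs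
  Unique-⊆⇒↭ {xs} {[]}     _              _    = xs , ↭-refl
  Unique-⊆⇒↭ {xs} {y ∷ ys} u@(_ ∷ ys!) y∷ys⊆xs
    with xs′ , xs↭ ← ∈⇒↭ (y∷ys⊆xs (here refl))
    with zs , xs′↭ ← Unique-⊆⇒↭ ys! (λ z∈ys →
           ∈-tail (∈-resp-↭ xs↭ (y∷ys⊆xs (there z∈ys))) (∉∧∈⇒≢ (head∉tail u) z∈ys))
    = zs , ↭-trans xs↭ (prep y xs′↭)

  Unique-⊆⇒length≤ : ∀ {xs ys : List A} → Unique ys → ys ⊆ xs → length ys ≤ length xs
  Unique-⊆⇒length≤ {xs} {ys} ys! ys⊆xs with zs , xs↭ ← Unique-⊆⇒↭ ys! ys⊆xs =
    subst (length ys ≤_) (sym (trans (↭-length xs↭) (length-++ ys))) (ℕₚ.m≤m+n _ _)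

  Unique-⊆-length⇒↭ : ∀ {xs ys : List A} → Unique ys → ys ⊆ xs → length ys ≡ length xs → xs ↭ ys
  Unique-⊆-length⇒↭ {xs} {ys} ys! ys⊆xs |ys|≡|xs|
    with zs , xs↭ ← Unique-⊆⇒↭ ys! ys⊆xs
    with zs | xs↭ | ℕₚ.+-cancelˡ-≡ (length ys) (length zs) 0
           (trans (trans (sym (length-++ ys)) (sym (↭-length xs↭)))
             (trans (sym |ys|≡|xs|) (sym (ℕₚ.+-identityʳ _))))
  ... | [] | xs↭ys++[] | _ = ↭-trans xs↭ys++[] (↭-reflexive (++-identityʳ ys))

  length-filter-parity : ∀ (χ : A → Parity) xs →
    length (filter (λ x → χ x ℙ.≟ 0ℙ) xs) + length (filter (λ x → χ x ℙ.≟ 1ℙ) xs) ≡ length xs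
  length-filter-parity χ []       = refl
  length-filter-parity χ (x ∷ xs) with χ x
  ... | 0ℙ = cong ℕ.suc (length-filter-parity χ xs)
  ... | 1ℙ = trans (ℕₚ.+-suc _ _) (cong ℕ.suc (length-filter-parity χ xs))

Unique⇒length≤ : ∀ {n} {xs : List (Fin n)} → Unique xs → length xs ≤ n
Unique⇒length≤ {n} {xs} xs! =
  subst (length xs ≤_) (length-tabulate {n = n} id) (Unique-⊆⇒length≤ xs! λ {x} _ → ∈-allFin x)

length≡suc⇒∃∈ : ∀ {a} {A : Set a} {xs : List A} {n} → length xs ≡ ℕ.suc n → ∃[ x ] x ∈ xs
length≡suc⇒∃∈ {xs = x ∷ _} _ = x , here refl

odd⇒1+2* : ∀ n → parity n ≡ 1ℙ → ∃[ i ] n ≡ 1 + 2 ℕ.* i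
odd⇒1+2* 1                 _     = 0 , refl
odd⇒1+2* (ℕ.suc (ℕ.suc n)) n-odd with i , refl ← odd⇒1+2* n n-odd =
  ℕ.suc i , cong ℕ.suc (sym (ℕₚ.*-suc 2 i))

-- A constructive form of "some element gives `Q`, or all of them give `R`"; `forces-2+k` applies it
-- to the deletions of single elements.
∈-traverse : ∀ {a q r} {A : Set a} {Q : Set q} {R : A → Set r} xs →
             (∀ {x} → x ∈ xs → Q ⊎ R x) → Q ⊎ (∀ {x} → x ∈ xs → R x)
∈-traverse []       f = inj₂ λ ()
∈-traverse (x ∷ xs) f with f (here refl) | ∈-traverse xs (f ∘ there)
... | inj₁ q | _      = inj₁ q
... | inj₂ _ | inj₁ q = inj₁ q
... | inj₂ r | inj₂ g = inj₂ λ { (here refl) → r ; (there x∈xs) → g x∈xs }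

module _ {n : ℕ} where
  open import Data.List.Membership.DecPropositional (Fin._≟_ {n}) public using (_∈?_)

-- Residues modulo p through integer representatives.

module Residues (p : ℕ) .{{_ : NonZero p}} where
  open Modular p using (_⊕_)
  open Defs.Barycentric (ℤ/ p) using (_·_; sum)

  ι : Fin p → ℤ
  ι = +_ ∘ toℕ

  opaque
    -- Sets live in `Fin p`, but computation takes place on integers, where a congruence is
    -- divisibility of a difference and can be rearranged by ring identities.
    ⟦_⟧ : ℤ → Fin p
    ⟦ z ⟧ = fromℕ< (ℤ.n%ℕd<d z p)

    toℕ-⟦⟧ : ∀ z → toℕ ⟦ z ⟧ ≡ z ℤ.%ℕ p
    toℕ-⟦⟧ z = Fin.toℕ-fromℕ< (ℤ.n%ℕd<d z p)

    ⟦+⟧≡mod : ∀ n → ⟦ + n ⟧ ≡ n ℕ.mod p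
    ⟦+⟧≡mod n = refl

  z≈ι⟦z⟧ : ∀ z → + p ∣ℤ z ℤ.- ι ⟦ z ⟧
  z≈ι⟦z⟧ z = divides (z ℤ./ℕ p) (trans
    (cong₂ (λ r r′ → r ℤ.- + r′) (ℤ.a≡a%ℕn+[a/ℕn]*n z p) (toℕ-⟦⟧ z))
    (eq (+ (z ℤ.%ℕ p)) (z ℤ./ℕ p ℤ.* + p)))
    where
    eq : ∀ r q → r ℤ.+ q ℤ.- r ≡ q
    eq = solve-∀

  -- Two representatives in [0, p) differ by less than p in absolute value, and the only multiple of
  -- p that small is 0.
  ι-injective : ∀ {x y} → + p ∣ℤ ι x ℤ.- ι y → x ≡ y
  ι-injective {x} {y} p∣x-y = Fin.toℕ-injective (ℤₚ.+-injective (ℤₚ.i-j≡0⇒i≡j (ι x) (ι y)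
    (ℤₚ.∣i∣≡0⇒i≡0 (small (ℤ∣.∣⇒∣ᵤ p∣x-y) bound))))
    where
    small : ∀ {d} → p ℕ∣.∣ d → d ℕ.< p → d ≡ 0
    small {ℕ.zero}  _   _   = refl
    small {ℕ.suc d} p∣d d<p = contradiction p∣d (ℕ∣.>⇒∤ d<p)
    bound : ℤ.∣ ι x ℤ.- ι y ∣ ℕ.< p
    bound = ℕₚ.≤-<-trans
      (ℕₚ.≤-trans (ℕₚ.≤-reflexive (cong ℤ.∣_∣ (ℤₚ.m-n≡m⊖n (toℕ x) (toℕ y))))
                  (ℤₚ.∣m⊝n∣≤m⊔n (toℕ x) (toℕ y)))
      (ℕₚ.⊔-pres-<m (Fin.toℕ<n x) (Fin.toℕ<n y))

  ≈⇒≡ : ∀ x y → + p ∣ℤ x ℤ.- y → ⟦ x ⟧ ≡ ⟦ y ⟧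
  ≈⇒≡ x y x≈y = ι-injective (subst (+ p ∣ℤ_) (eq x y (ι ⟦ x ⟧) (ι ⟦ y ⟧))
    (ℤ∣.∣m∣n⇒∣m+n (ℤ∣.∣m∣n⇒∣m-n x≈y (z≈ι⟦z⟧ x)) (z≈ι⟦z⟧ y)))
    where
    eq : ∀ x y x′ y′ → x ℤ.- y ℤ.- (x ℤ.- x′) ℤ.+ (y ℤ.- y′) ≡ x′ ℤ.- y′
    eq = solve-∀

  ≡⇒≈ : ∀ x y → ⟦ x ⟧ ≡ ⟦ y ⟧ → + p ∣ℤ x ℤ.- y
  ≡⇒≈ x y eqn = subst (+ p ∣ℤ_)
    (trans (cong (λ r → x ℤ.- ι r ℤ.- (y ℤ.- ι ⟦ y ⟧)) eqn) (eq x y (ι ⟦ y ⟧)))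
    (ℤ∣.∣m∣n⇒∣m-n (z≈ι⟦z⟧ x) (z≈ι⟦z⟧ y))
    where
    eq : ∀ x y r → x ℤ.- r ℤ.- (y ℤ.- r) ≡ x ℤ.- y
    eq = solve-∀

  ⟦ι⟧ : ∀ x → ⟦ ι x ⟧ ≡ x
  ⟦ι⟧ x = ι-injective (subst (+ p ∣ℤ_) (eq (ι x) (ι ⟦ ι x ⟧)) (ℤ∣.∣m⇒∣-m (z≈ι⟦z⟧ (ι x))))
    where
    eq : ∀ x r → ℤ.- (x ℤ.- r) ≡ r ℤ.- x
    eq = solve-∀

  ⟦⟧-⊕ : ∀ x y → ⟦ x ⟧ ⊕ ⟦ y ⟧ ≡ ⟦ x ℤ.+ y ⟧
  ⟦⟧-⊕ x y = trans (sym (⟦+⟧≡mod _)) (≈⇒≡ (ι ⟦ x ⟧ ℤ.+ ι ⟦ y ⟧) (x ℤ.+ y) (subst (+ p ∣ℤ_) (eq x y (ι ⟦ x ⟧) (ι ⟦ y ⟧))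
    (ℤ∣.∣m⇒∣-m (ℤ∣.∣m∣n⇒∣m+n (z≈ι⟦z⟧ x) (z≈ι⟦z⟧ y)))))
    where
    eq : ∀ x y x′ y′ → ℤ.- (x ℤ.- x′ ℤ.+ (y ℤ.- y′)) ≡ x′ ℤ.+ y′ ℤ.- (x ℤ.+ y)
    eq = solve-∀

  ⟦⟧-· : ∀ n x → n · ⟦ x ⟧ ≡ ⟦ + n ℤ.* x ⟧
  ⟦⟧-· ℕ.zero    x = sym (⟦+⟧≡mod 0)
  ⟦⟧-· (ℕ.suc n) x = trans (cong (⟦ x ⟧ ⊕_) (⟦⟧-· n x)) (trans (⟦⟧-⊕ x (+ n ℤ.* x))
    (cong ⟦_⟧ (trans (eq (+ n) x) (cong (ℤ._* x) (sym (ℤₚ.pos-+ 1 n))))))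
    where
    eq : ∀ n x → x ℤ.+ n ℤ.* x ≡ (+ 1 ℤ.+ n) ℤ.* x
    eq = solve-∀

  sum-resp-↭ : ∀ {xs ys} → xs ↭ ys → sum xs ≡ sum ys
  sum-resp-↭ = ↭ₛ.foldr-commMonoid (setoid (Fin p)) isCommutativeMonoid ∘ ↭⇒↭ₛ
    where open AbelianGroup (ℤ/ p) using (isCommutativeMonoid)

  sum-tail : ∀ S a {xs ys} → sum xs ≡ ⟦ S ⟧ → xs ↭ ⟦ a ⟧ ∷ ys → sum ys ≡ ⟦ S ℤ.- a ⟧
  sum-tail S a {xs} {ys} sum≡S xs↭ = trans (sym (⟦ι⟧ (sum ys))) (≈⇒≡ s (S ℤ.- a) (subst (+ p ∣ℤ_) (eq a s S)
    (≡⇒≈ (a ℤ.+ s) S (trans (sym (⟦⟧-⊕ a s)) (trans (cong (⟦ a ⟧ ⊕_) (⟦ι⟧ (sum ys)))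
      (trans (sym (sum-resp-↭ xs↭)) sum≡S))))))
    where
    s = ι (sum ys)
    eq : ∀ a s S → a ℤ.+ s ℤ.- S ≡ s ℤ.- (S ℤ.- a)
    eq = solve-∀

-- Units modulo p = 2k + 1 and barycentres of k-sets.

module OddModulus (p k : ℕ) .{{_ : NonZero p}} (p-prime : Prime p) (7≤p : 7 ≤ p)
                  (p≡1+2k : p ≡ 1 + 2 ℕ.* k) where
  open Modular p using (_⊕_)
  open Defs.Barycentric (ℤ/ p) using (_·_; sum; IsBarycentric; ForcesBarycentric)
  open Residues p

  -- The modulus p as an integer polynomial in k, the form in which ring identities produce its
  -- multiples.
  1+2K = + 1 ℤ.+ + 2 ℤ.* + k

  p∣1+2K* : ∀ x → + p ∣ℤ 1+2K ℤ.* x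
  p∣1+2K* x = subst (λ q → + p ∣ℤ q ℤ.* x)
    (trans (cong +_ p≡1+2k) (trans (ℤₚ.pos-+ 1 (2 ℕ.* k)) (cong (ℤ._+_ (+ 1)) (ℤₚ.pos-* 2 k))))
    (ℤ∣.∣m⇒∣m*n x ℤ∣.∣-refl)

  infix 4 _∤_
  _∤_ : ℕ → ℤ → Set
  n ∤ z = ¬ (+ n ∣ℤ z)

  p∣*⇒p∣ʳ : ∀ x y → p ∤ x → + p ∣ℤ x ℤ.* y → + p ∣ℤ y
  p∣*⇒p∣ʳ x y p∤x p∣xy
    with euclidsLemma ℤ.∣ x ∣ ℤ.∣ y ∣ p-prime (subst (p ℕ∣.∣_) (ℤₚ.abs-* x y) (ℤ∣.∣⇒∣ᵤ p∣xy))
  ... | inj₁ p∣x = contradiction (ℤ∣.∣ᵤ⇒∣ p∣x) p∤x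
  ... | inj₂ p∣y = ℤ∣.∣ᵤ⇒∣ p∣y

  p∤* : ∀ x y → p ∤ x → p ∤ y → p ∤ x ℤ.* y
  p∤* x y p∤x p∤y = p∤y ∘ p∣*⇒p∣ʳ x y p∤x

  p∤small : ∀ z .{{_ : NonZero ℤ.∣ z ∣}} → ℤ.∣ z ∣ ℕ.< p → p ∤ z
  p∤small z ∣z∣<p = ℕ∣.>⇒∤ ∣z∣<p ∘ ℤ∣.∣⇒∣ᵤ

  -- The numerical constants of the argument are at most 6 in absolute value or products of such
  -- numbers, so `7 ≤ p` makes them all units.
  p∤≤6 : ∀ z .{{_ : NonZero ℤ.∣ z ∣}} {∣z∣≤6 : True (ℤ.∣ z ∣ ℕₚ.≤? 6)} → p ∤ z
  p∤≤6 z {∣z∣≤6} = p∤small z (ℕₚ.≤-trans (ℕ.s≤s (toWitness ∣z∣≤6)) 7≤p)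

  2*-injective : ∀ x y → + p ∣ℤ + 2 ℤ.* x ℤ.- + 2 ℤ.* y → ⟦ x ⟧ ≡ ⟦ y ⟧
  2*-injective x y p∣ with ⟦ x ⟧ Fin.≟ ⟦ y ⟧
  ... | yes eqn = eqn
  ... | no x≢y = contradiction (subst (+ p ∣ℤ_) (eq x y) p∣)
                   (p∤* (+ 2) (x ℤ.- y) (p∤≤6 (+ 2)) (x≢y ∘ ≈⇒≡ x y))
    where
    eq : ∀ x y → + 2 ℤ.* x ℤ.- + 2 ℤ.* y ≡ + 2 ℤ.* (x ℤ.- y)
    eq = solve-∀

  -- As 2k ≡ -1, the barycentre of a k-set is -2 times its sum.
  -2T⇒k·≡T : ∀ T → ⟦ T ⟧ ≡ k · ⟦ ℤ.- (+ 2 ℤ.* T) ⟧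
  -2T⇒k·≡T T = sym (trans (⟦⟧-· k _) (sym (≈⇒≡ T (+ k ℤ.* ℤ.- (+ 2 ℤ.* T))
    (subst (+ p ∣ℤ_) (eq (+ k) T) (p∣1+2K* T)))))
    where
    eq : ∀ k T → (+ 1 ℤ.+ + 2 ℤ.* k) ℤ.* T ≡ T ℤ.- k ℤ.* ℤ.- (+ 2 ℤ.* T)
    eq = solve-∀

  -- Multiply T = kg by -2 and use -2k = 1 modulo p.
  k·≡T⇒-2T : ∀ T g → ⟦ T ⟧ ≡ k · g → g ≡ ⟦ ℤ.- (+ 2 ℤ.* T) ⟧
  k·≡T⇒-2T T g T≡k·g = trans (sym (⟦ι⟧ g)) (≈⇒≡ y (ℤ.- (+ 2 ℤ.* T)) (subst (+ p ∣ℤ_) (eq (+ k) T y)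
    (ℤ∣.∣m∣n⇒∣m+n (p∣1+2K* y) (ℤ∣.∣n⇒∣m*n (+ 2) (≡⇒≈ T (+ k ℤ.* y)
      (trans T≡k·g (trans (cong (k ·_) (sym (⟦ι⟧ g))) (⟦⟧-· k y))))))))
    where
    y = ι g
    eq : ∀ k T y → (+ 1 ℤ.+ + 2 ℤ.* k) ℤ.* y ℤ.+ + 2 ℤ.* (T ℤ.- k ℤ.* y) ≡ y ℤ.- (ℤ.- (+ 2 ℤ.* T))
    eq = solve-∀

  -- Barycentric k-subsets of (k+1)-sets as a doubling condition.

  HasBarycentric : List (Fin p) → Set
  HasBarycentric A = ∃[ B ] (B ⊆ A × IsBarycentric k B)

  -- For a (k+1)-set A with sum S, the k-set A ∖ {z} has barycentre 2(z - S),
  -- which is the image of z under doubling about the point 2S.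
  DoubleFree : List (Fin p) → ℤ → Set
  DoubleFree A S = ∀ z → ⟦ z ⟧ ∈ A → ⟦ + 2 ℤ.* (z ℤ.- S) ⟧ ∈ A → ⟦ + 2 ℤ.* (z ℤ.- S) ⟧ ≡ ⟦ z ⟧

  DoubleFree-resp : ∀ {A} S S′ → + p ∣ℤ S ℤ.- S′ → DoubleFree A S → DoubleFree A S′
  DoubleFree-resp {A} S S′ S≈S′ free z z∈A f∈A = trans (sym f≡) (free z z∈A (subst (_∈ A) (sym f≡) f∈A))
    where
    eq : ∀ z S S′ → ℤ.- (+ 2) ℤ.* (S ℤ.- S′) ≡ + 2 ℤ.* (z ℤ.- S) ℤ.- + 2 ℤ.* (z ℤ.- S′)
    eq = solve-∀
    f≡ : ⟦ + 2 ℤ.* (z ℤ.- S) ⟧ ≡ ⟦ + 2 ℤ.* (z ℤ.- S′) ⟧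
    f≡ = ≈⇒≡ _ _ (subst (+ p ∣ℤ_) (eq z S S′) (ℤ∣.∣n⇒∣m*n (ℤ.- (+ 2)) S≈S′))

  -- A finite search looks for a in A whose image 2(a - S) is another element of A. Such an image
  -- survives the deletion of a and is the barycentre of what remains.
  HasBarycentric⊎DoubleFree : ∀ {A} S → Unique A → length A ≡ 1 + k → sum A ≡ ⟦ S ⟧ →
                              HasBarycentric A ⊎ DoubleFree A S
  HasBarycentric⊎DoubleFree {A} S A! |A| sumA
    with any? (λ a → (g a ∈? A) ×-dec ¬? (g a Fin.≟ a)) A
    where
    g : Fin p → Fin p
    g a = ⟦ + 2 ℤ.* (ι a ℤ.- S) ⟧
  ... | yes any with a , a∈A , g∈A , g≢a ← find any with B , A↭ ← ∈⇒↭ a∈A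
    with A!′@(_ ∷ B!) ← Unique-resp-↭ A↭ A! =
    inj₁ (B , (λ b∈B → ∈-resp-↭ (↭-sym A↭) (there b∈B)) , B! ,
      ℕₚ.suc-injective (trans (sym (↭-length A↭)) |A|) ,
      _ , ∈-tail (∈-resp-↭ A↭ g∈A) g≢a ,
      trans sumB (trans (-2T⇒k·≡T T) (cong (λ z → k · ⟦ z ⟧) (eq (ι a) S))))
    where
    T = S ℤ.- ι a
    sumB = sum-tail S (ι a) sumA (subst (λ x → A ↭ x ∷ B) (sym (⟦ι⟧ a)) A↭)
    eq : ∀ a S → ℤ.- (+ 2 ℤ.* (S ℤ.- a)) ≡ + 2 ℤ.* (a ℤ.- S)
    eq = solve-∀
  ... | no ¬any = inj₂ λ z z∈A g∈A → trans (g≡ z) (decidable-stable (_ Fin.≟ _) λ g≢z →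
        ¬any (lose z∈A (subst (_∈ A) (g≡ z) g∈A , g≢z)))
    where
    eq : ∀ z z′ S → + 2 ℤ.* (z ℤ.- z′) ≡ + 2 ℤ.* (z ℤ.- S) ℤ.- + 2 ℤ.* (z′ ℤ.- S)
    eq = solve-∀
    g≡ : ∀ z → ⟦ + 2 ℤ.* (z ℤ.- S) ⟧ ≡ ⟦ + 2 ℤ.* (ι ⟦ z ⟧ ℤ.- S) ⟧
    g≡ z = ≈⇒≡ _ _ (subst (+ p ∣ℤ_) (eq z (ι ⟦ z ⟧) S) (ℤ∣.∣n⇒∣m*n (+ 2) (z≈ι⟦z⟧ z)))

  -- A k-subset B omits exactly one element a of A, so its barycentre is 2(a - S). If this lies in
  -- B, double-freeness identifies it with a, which is not in B.
  DoubleFree⇒¬HasBarycentric : ∀ {A} S → Unique A → length A ≡ 1 + k → sum A ≡ ⟦ S ⟧ →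
                               DoubleFree A S → ¬ HasBarycentric A
  DoubleFree⇒¬HasBarycentric {A} S A! |A| sumA free (B , B⊆A , B! , |B| , g , g∈B , sumB)
    with C , A↭B++C ← Unique-⊆⇒↭ B! B⊆A
    with C | A↭B++C | ℕₚ.+-cancelˡ-≡ k (length C) 1 (trans (cong (_+ length C) (sym |B|))
               (trans (sym (length-++ B)) (trans (sym (↭-length A↭B++C)) (trans |A| (ℕₚ.+-comm 1 k)))))
  ... | a ∷ [] | A↭B++[a] | _ = ∉∧∈⇒≢ a∉B g∈B (trans g≡ (trans (free (ι a)
          (∈-resp-↭ (↭-sym A↭) (here (⟦ι⟧ a))) (subst (_∈ A) g≡ (B⊆A g∈B))) (⟦ι⟧ a)))
    where
    A↭ : A ↭ a ∷ B
    A↭ = ↭-trans A↭B++[a] (↭-trans (shift a B []) (prep a (↭-reflexive (++-identityʳ B))))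
    a∉B = head∉tail (Unique-resp-↭ A↭ A!)
    T = S ℤ.- ι a
    eq : ∀ a S → ℤ.- (+ 2 ℤ.* (S ℤ.- a)) ≡ + 2 ℤ.* (a ℤ.- S)
    eq = solve-∀
    g≡ : g ≡ ⟦ + 2 ℤ.* (ι a ℤ.- S) ⟧
    g≡ = trans (k·≡T⇒-2T T g (trans (sym (sum-tail S (ι a) sumA
           (subst (λ x → A ↭ x ∷ B) (sym (⟦ι⟧ a)) A↭))) sumB)) (cong ⟦_⟧ (eq (ι a) S))

  -- The k-sets A ∖ {2S} and 2(A - S) ∖ {2S} are disjoint, so they partition ℤ/p ∖ {2S}.
  module MaximalDoubleFree {A} (S : ℤ) (A! : Unique A) (|A| : length A ≡ 1 + k)
                           (free : DoubleFree A S) where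

    c : ℤ
    c = + 2 ℤ.* S

    f : Fin p → Fin p
    f x = ⟦ + 2 ℤ.* (ι x ℤ.- S) ⟧

    f-injective : ∀ {x y} → f x ≡ f y → x ≡ y
    f-injective {x} {y} fx≡fy = trans (sym (⟦ι⟧ x)) (trans
      (2*-injective (ι x) (ι y) (subst (+ p ∣ℤ_) (eq (ι x) (ι y) S) (≡⇒≈ _ _ fx≡fy))) (⟦ι⟧ y))
      where
      eq : ∀ x y S → + 2 ℤ.* (x ℤ.- S) ℤ.- + 2 ℤ.* (y ℤ.- S) ≡ + 2 ℤ.* x ℤ.- + 2 ℤ.* y
      eq = solve-∀

    fx≡x⇒x≡c : ∀ {x} → f x ≡ x → x ≡ ⟦ c ⟧
    fx≡x⇒x≡c {x} fx≡x = trans (sym (⟦ι⟧ x)) (≈⇒≡ (ι x) c (subst (+ p ∣ℤ_) (eq (ι x) S)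
      (≡⇒≈ _ (ι x) (trans fx≡x (sym (⟦ι⟧ x))))))
      where
      eq : ∀ x S → + 2 ℤ.* (x ℤ.- S) ℤ.- x ≡ x ℤ.- + 2 ℤ.* S
      eq = solve-∀

    x,fx∈A⇒x≡c : ∀ {x} → x ∈ A → f x ∈ A → x ≡ ⟦ c ⟧
    x,fx∈A⇒x≡c {x} x∈A fx∈A =
      fx≡x⇒x≡c (trans (free (ι x) (subst (_∈ A) (sym (⟦ι⟧ x)) x∈A) fx∈A) (⟦ι⟧ x))

    -- An element f x common to D and f D has both x and f x in A, which forces x to be the centre.
    ++-map-f! : ∀ {D} → Unique D → D ⊆ A → ⟦ c ⟧ ∉ D → Unique (D ++ map f D)
    ++-map-f! {D} D! D⊆A c∉D = Unique.++⁺ D! (Unique.map⁺ f-injective D!) λ (fx∈D , fx∈fD) →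
      let x , x∈D , eqn = ∈-map⁻ f fx∈fD
      in c∉D (subst (_∈ D) (x,fx∈A⇒x≡c (D⊆A x∈D) (subst (_∈ A) eqn (D⊆A fx∈D))) x∈D)

    |++-map-f| : ∀ D → length (D ++ map f D) ≡ 2 ℕ.* length D
    |++-map-f| D = trans (length-++ D) (cong (ℕ._+_ (length D))
      (trans (length-map f D) (sym (ℕₚ.+-identityʳ (length D)))))

    -- Otherwise A and f A would be disjoint and supply 2(k + 1) = p + 1 residues.
    c∈A : ⟦ c ⟧ ∈ A
    c∈A = decidable-stable (⟦ c ⟧ ∈? A) λ c∉A → ℕₚ.<⇒≱ (ℕₚ.n<1+n p) (begin
      1 + p                    ≡⟨ cong ℕ.suc p≡1+2k ⟩
      2 + 2 ℕ.* k              ≡⟨ ℕₚ.*-suc 2 k ⟨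
      2 ℕ.* (1 + k)            ≡⟨ cong (2 ℕ.*_) |A| ⟨
      2 ℕ.* length A           ≡⟨ |++-map-f| A ⟨
      length (A ++ map f A)    ≤⟨ Unique⇒length≤ (++-map-f! A! id c∉A) ⟩
      p                        ∎)
      where open ℕₚ.≤-Reasoning

    opaque
      rest : ∃[ D ] A ↭ ⟦ c ⟧ ∷ D
      rest = ∈⇒↭ c∈A

    private
      D = proj₁ rest
      A↭c∷D : A ↭ ⟦ c ⟧ ∷ D
      A↭c∷D = proj₂ rest
      c∷D! = Unique-resp-↭ A↭c∷D A!
      c∉D = head∉tail c∷D!
      D⊆A : D ⊆ A
      D⊆A = ∈-resp-↭ (↭-sym A↭c∷D) ∘ there
      |D| : length D ≡ k
      |D| = ℕₚ.suc-injective (trans (sym (↭-length A↭c∷D)) |A|)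

    D++fD! : Unique (⟦ c ⟧ ∷ D ++ map f D)
    D++fD! = ¬Any⇒All¬ _ c∉D++fD ∷ ++-map-f! (tail c∷D!) D⊆A c∉D
      where
      c≡fc : ⟦ c ⟧ ≡ f ⟦ c ⟧
      c≡fc = ≈⇒≡ c _ (subst (+ p ∣ℤ_) (eq S (ι ⟦ c ⟧)) (ℤ∣.∣n⇒∣m*n (+ 2) (z≈ι⟦z⟧ c)))
        where
        eq : ∀ S c′ → + 2 ℤ.* (+ 2 ℤ.* S ℤ.- c′) ≡ + 2 ℤ.* S ℤ.- + 2 ℤ.* (c′ ℤ.- S)
        eq = solve-∀
      c∉D++fD : ⟦ c ⟧ ∉ D ++ map f D
      c∉D++fD c∈ with ∈-++⁻ D c∈
      ... | inj₁ c∈D = c∉D c∈D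
      ... | inj₂ c∈fD with x , x∈D , c≡fx ← ∈-map⁻ f c∈fD =
        c∉D (subst (_∈ D) (f-injective (trans (sym c≡fx) c≡fc)) x∈D)

    -- The centre, D and f D already make up 1 + 2k = p distinct residues, which leaves no room for
    -- another.
    covers : ∀ w → w ≡ ⟦ c ⟧ ⊎ w ∈ D ⊎ w ∈ map f D
    covers w with w ∈? (⟦ c ⟧ ∷ D ++ map f D)
    ... | yes (here w≡c) = inj₁ w≡c
    ... | yes (there w∈) = inj₂ (∈-++⁻ D w∈)
    ... | no w∉ = contradiction (Unique⇒length≤ (¬Any⇒All¬ _ w∉ ∷ D++fD!)) (ℕₚ.<⇒≱ (ℕ.s≤s
          (ℕₚ.≤-reflexive (trans p≡1+2k (cong ℕ.suc (sym (trans (|++-map-f| D) (cong (2 ℕ.*_) |D|))))))))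

    -- With the origin moved to c, the map f is z ↦ 2z; double-freeness would give 2z = z.
    c+2z∉A : ∀ z → p ∤ z → ⟦ c ℤ.+ z ⟧ ∈ A → ⟦ c ℤ.+ + 2 ℤ.* z ⟧ ∉ A
    c+2z∉A z p∤z z∈A 2z∈A = p∤z (subst (+ p ∣ℤ_) (eq₂ c z) (≡⇒≈ _ _
      (trans 2z≡ (free _ z∈A (subst (_∈ A) 2z≡ 2z∈A)))))
      where
      eq₁ : ∀ S z → + 2 ℤ.* S ℤ.+ + 2 ℤ.* z ≡ + 2 ℤ.* (+ 2 ℤ.* S ℤ.+ z ℤ.- S)
      eq₁ = solve-∀
      2z≡ = cong ⟦_⟧ (eq₁ S z)
      eq₂ : ∀ c z → c ℤ.+ + 2 ℤ.* z ℤ.- (c ℤ.+ z) ≡ z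
      eq₂ = solve-∀

    -- By `covers`, a point outside A is the image of an element of D; as doubling is injective,
    -- that element would be c + z.
    c+2z∈A : ∀ z → ⟦ c ℤ.+ z ⟧ ∉ A → ⟦ c ℤ.+ + 2 ℤ.* z ⟧ ∈ A
    c+2z∈A z z∉A with covers ⟦ c ℤ.+ + 2 ℤ.* z ⟧
    ... | inj₁ ≡c = subst (_∈ A) (sym ≡c) c∈A
    ... | inj₂ (inj₁ ∈D) = D⊆A ∈D
    ... | inj₂ (inj₂ ∈fD) with d , d∈D , ≡fd ← ∈-map⁻ f ∈fD = contradiction (D⊆A (subst (_∈ D)
          (trans (sym (⟦ι⟧ d)) (2*-injective (ι d) (c ℤ.+ z)
            (subst (+ p ∣ℤ_) (eq S z (ι d)) (≡⇒≈ _ _ (sym ≡fd))))) d∈D)) z∉A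
      where
      eq : ∀ S z d → + 2 ℤ.* (d ℤ.- S) ℤ.- (+ 2 ℤ.* S ℤ.+ + 2 ℤ.* z) ≡ + 2 ℤ.* d ℤ.- + 2 ℤ.* (+ 2 ℤ.* S ℤ.+ z)
      eq = solve-∀

    c+4z∈A : ∀ z → p ∤ z → ⟦ c ℤ.+ z ⟧ ∈ A → ⟦ c ℤ.+ + 4 ℤ.* z ⟧ ∈ A
    c+4z∈A z p∤z z∈A = subst (λ w → ⟦ c ℤ.+ w ⟧ ∈ A) (sym (ℤₚ.*-assoc (+ 2) (+ 2) z))
      (c+2z∈A (+ 2 ℤ.* z) (c+2z∉A z p∤z z∈A))

    non-centre : 0 ℕ.< k → ∃[ z ] (p ∤ z × ⟦ c ℤ.+ z ⟧ ∈ A)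
    non-centre 0<k with D | c∉D | D⊆A | |D|
    ... | []    | _   | _   | refl = contradiction 0<k λ ()
    ... | d ∷ _ | c∉D | D⊆A | _    = ι d ℤ.- c ,
      (λ p∣ → c∉D (here (sym (trans (sym (⟦ι⟧ d)) (≈⇒≡ (ι d) c p∣))))) ,
      D⊆A (here (trans (cong ⟦_⟧ (eq c (ι d))) (⟦ι⟧ d)))
      where
      eq : ∀ c d → c ℤ.+ (d ℤ.- c) ≡ d
      eq = solve-∀

  -- Odd order: no (k+1)-set is double-free.

  0<k : 0 ℕ.< k
  0<k = ℕₚ.n≢0⇒n>0 λ k≡0 → ℕₚ.<⇒≱ (ℕ.s≤s (ℕ.s≤s ℕ.z≤n))
    (subst (λ k → 7 ≤ 1 + 2 ℕ.* k) k≡0 (subst (7 ≤_) p≡1+2k 7≤p))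

  2^suc : ∀ n → + (2 ℕ.^ ℕ.suc n) ≡ + 2 ℤ.* + (2 ℕ.^ n)
  2^suc n = ℤₚ.pos-* 2 (2 ℕ.^ n)

  p∤2^ : ∀ n → p ∤ + (2 ℕ.^ n)
  p∤2^ ℕ.zero    = p∤≤6 (+ 1)
  p∤2^ (ℕ.suc n) = subst (p ∤_) (sym (2^suc n)) (p∤* (+ 2) _ (p∤≤6 (+ 2)) (p∤2^ n))

  -- Write t = 2i + 1 and take c + z in A off the centre. Stability under z ↦ 4z puts c + 4^i z in
  -- A, yet its double about c is c + 2^t z = c + z, again in A.
  odd-order⇒¬DoubleFree : ∀ {t} → parity t ≡ 1ℙ → + p ∣ℤ + (2 ℕ.^ t) ℤ.- + 1 →
    ∀ {A} S → Unique A → length A ≡ 1 + k → ¬ DoubleFree A S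
  odd-order⇒¬DoubleFree {t} t-odd 2^t≈1 {A} S A! |A| free
    with z , p∤z , z∈A ← MaximalDoubleFree.non-centre S A! |A| free 0<k
    with i , refl ← odd⇒1+2* t t-odd
    = c+2z∉A _ (p∤* _ z (p∤2^ (2 ℕ.* i)) p∤z) (4^iz∈A i)
        (subst (_∈ A) (sym (≈⇒≡ _ _ (subst (+ p ∣ℤ_) (eq₁ c z (+ (2 ℕ.^ (2 ℕ.* i))))
          (ℤ∣.∣m⇒∣m*n z (subst (λ q → + p ∣ℤ q ℤ.- + 1) (2^suc (2 ℕ.* i)) 2^t≈1))))) z∈A)
    where
    open MaximalDoubleFree S A! |A| free
    eq₁ : ∀ c z q → (+ 2 ℤ.* q ℤ.- + 1) ℤ.* z ≡ c ℤ.+ + 2 ℤ.* (q ℤ.* z) ℤ.- (c ℤ.+ z)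
    eq₁ = solve-∀
    eq₂ : ∀ c z q → c ℤ.+ + 4 ℤ.* (q ℤ.* z) ≡ c ℤ.+ + 2 ℤ.* (+ 2 ℤ.* q) ℤ.* z
    eq₂ = solve-∀
    2^[2*suc] : ∀ i → + (2 ℕ.^ (2 ℕ.* ℕ.suc i)) ≡ + 2 ℤ.* (+ 2 ℤ.* + (2 ℕ.^ (2 ℕ.* i)))
    2^[2*suc] i = trans (cong (λ n → + (2 ℕ.^ n)) (ℕₚ.*-suc 2 i))
      (trans (2^suc (1 + 2 ℕ.* i)) (cong (+ 2 ℤ.*_) (2^suc (2 ℕ.* i))))
    4^iz∈A : ∀ i → ⟦ c ℤ.+ + (2 ℕ.^ (2 ℕ.* i)) ℤ.* z ⟧ ∈ A
    4^iz∈A ℕ.zero    = subst (λ w → ⟦ c ℤ.+ w ⟧ ∈ A) (sym (ℤₚ.*-identityˡ z)) z∈A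
    4^iz∈A (ℕ.suc i) = subst (λ w → ⟦ w ⟧ ∈ A)
      (trans (eq₂ c z (+ (2 ℕ.^ (2 ℕ.* i)))) (cong (λ q → c ℤ.+ q ℤ.* z) (sym (2^[2*suc] i))))
      (c+4z∈A _ (p∤* _ z (p∤2^ (2 ℕ.* i)) p∤z) (4^iz∈A i))

  -- Sets of k + 2 elements.

  -- Every (k+1)-subset of a (k+2)-set A being double-free, membership in A
  -- propagates along the progression a + jv for v = 3a - 2S: the centre for
  -- A ∖ {a + jv} is a - (2j + 1)v.
  ¬all-deletions-DoubleFree : ∀ {A} S → Unique A → length A ≡ 2 + k →
    ¬ (∀ z → ⟦ z ⟧ ∈ A → ∃[ B ] (A ↭ ⟦ z ⟧ ∷ B × DoubleFree B (S ℤ.- z)))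
  ¬all-deletions-DoubleFree {A} S A! |A| deletion = impossible
    where
    module Deletion z (z∈A : ⟦ z ⟧ ∈ A) where
      B = proj₁ (deletion z z∈A)
      A↭ = proj₁ (proj₂ (deletion z z∈A))
      z∷B! = Unique-resp-↭ A↭ A!
      open MaximalDoubleFree (S ℤ.- z) (tail z∷B!) (ℕₚ.suc-injective (trans (sym (↭-length A↭)) |A|))
        (proj₂ (proj₂ (deletion z z∈A))) public
      B⊆A : B ⊆ A
      B⊆A = ∈-resp-↭ (↭-sym A↭) ∘ there
      z∉B : ⟦ z ⟧ ∉ B
      z∉B = head∉tail z∷B!
      ∈B : ∀ w → p ∤ w ℤ.- z → ⟦ w ⟧ ∈ A → ⟦ w ⟧ ∈ B
      ∈B w p∤w-z w∈A = ∈-tail (∈-resp-↭ A↭ w∈A) (p∤w-z ∘ ≡⇒≈ w z)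

    a₀ : ∃[ a ] a ∈ A
    a₀ = length≡suc⇒∃∈ |A|

    a = ι (proj₁ a₀)
    v = + 3 ℤ.* a ℤ.- + 2 ℤ.* S

    N : ℤ → Set
    N j = ⟦ a ℤ.+ j ℤ.* v ⟧ ∈ A

    -- The centre of a double-free (k+1)-set belongs to it; here that centre has index -1 - 2j.
    reflect : ∀ j → N j → N (ℤ.- + 1 ℤ.- + 2 ℤ.* j)
    reflect j j∈ = subst (_∈ A) (cong ⟦_⟧ (eq a S j)) (B⊆A c∈A)
      where
      open Deletion _ j∈
      eq : ∀ a S j → + 2 ℤ.* (S ℤ.- (a ℤ.+ j ℤ.* (+ 3 ℤ.* a ℤ.- + 2 ℤ.* S)))
                   ≡ a ℤ.+ (ℤ.- + 1 ℤ.- + 2 ℤ.* j) ℤ.* (+ 3 ℤ.* a ℤ.- + 2 ℤ.* S)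
      eq = solve-∀

    0∈ : N (+ 0)
    0∈ = subst (_∈ A) (trans (sym (⟦ι⟧ _)) (cong ⟦_⟧ (eq a v))) (proj₂ a₀)
      where
      eq : ∀ a v → a ≡ a ℤ.+ + 0 ℤ.* v
      eq = solve-∀

    -- The centre for A without a is a - v. Were v zero, it would be the deleted element a, although
    -- it belongs to the remaining set.
    p∤v : p ∤ v
    p∤v p∣v = z∉B (subst (_∈ B) (≈⇒≡ _ _ (subst (+ p ∣ℤ_) (eq a S) (ℤ∣.∣m⇒∣-m p∣v))) c∈A)
      where
      open Deletion _ 0∈
      eq : ∀ a S → ℤ.- (+ 3 ℤ.* a ℤ.- + 2 ℤ.* S) ≡
                   + 2 ℤ.* (S ℤ.- (a ℤ.+ + 0 ℤ.* (+ 3 ℤ.* a ℤ.- + 2 ℤ.* S))) ℤ.-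
                     (a ℤ.+ + 0 ℤ.* (+ 3 ℤ.* a ℤ.- + 2 ℤ.* S))
      eq = solve-∀

    module _ j i (j∈ : N j) (i∈ : N i) (p∤i-j : p ∤ i ℤ.- j) (p∤2j+i+1 : p ∤ + 2 ℤ.* j ℤ.+ i ℤ.+ + 1) where
      open Deletion _ j∈

      i∈B : ⟦ a ℤ.+ i ℤ.* v ⟧ ∈ B
      i∈B = ∈B _ (subst (p ∤_) (eq a i j v) (p∤* _ v p∤i-j p∤v)) i∈
        where
        eq : ∀ a i j v → (i ℤ.- j) ℤ.* v ≡ a ℤ.+ i ℤ.* v ℤ.- (a ℤ.+ j ℤ.* v)
        eq = solve-∀

      -- The displacement of a + iv from the centre of A without a + jv. The two hypotheses on i and
      -- j say that a + iv survives the deletion and is not the centre.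
      u = (+ 2 ℤ.* j ℤ.+ i ℤ.+ + 1) ℤ.* v
      p∤u = p∤* _ v p∤2j+i+1 p∤v

      c+u∈B : ⟦ c ℤ.+ u ⟧ ∈ B
      c+u∈B = subst (λ w → ⟦ w ⟧ ∈ B) (eq a S i j) i∈B
        where
        eq : ∀ a S i j → a ℤ.+ i ℤ.* (+ 3 ℤ.* a ℤ.- + 2 ℤ.* S)
               ≡ + 2 ℤ.* (S ℤ.- (a ℤ.+ j ℤ.* (+ 3 ℤ.* a ℤ.- + 2 ℤ.* S))) ℤ.+
                 (+ 2 ℤ.* j ℤ.+ i ℤ.+ + 1) ℤ.* (+ 3 ℤ.* a ℤ.- + 2 ℤ.* S)
        eq = solve-∀

      quadruple : N (+ 4 ℤ.* i ℤ.+ + 6 ℤ.* j ℤ.+ + 3)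
      quadruple = subst (_∈ A) (cong ⟦_⟧ (eq a S i j)) (B⊆A (c+4z∈A u p∤u c+u∈B))
        where
        eq : ∀ a S i j → + 2 ℤ.* (S ℤ.- (a ℤ.+ j ℤ.* (+ 3 ℤ.* a ℤ.- + 2 ℤ.* S))) ℤ.+
                 + 4 ℤ.* ((+ 2 ℤ.* j ℤ.+ i ℤ.+ + 1) ℤ.* (+ 3 ℤ.* a ℤ.- + 2 ℤ.* S))
               ≡ a ℤ.+ (+ 4 ℤ.* i ℤ.+ + 6 ℤ.* j ℤ.+ + 3) ℤ.* (+ 3 ℤ.* a ℤ.- + 2 ℤ.* S)
        eq = solve-∀

      -- The extra hypothesis says that the point with index 2i + 2j + 1 differs from the deleted
      -- one, hence would remain in `B`.
      ¬double : p ∤ + 2 ℤ.* i ℤ.+ j ℤ.+ + 1 → ¬ N (+ 2 ℤ.* i ℤ.+ + 2 ℤ.* j ℤ.+ + 1)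
      ¬double p∤ 2i∈ = c+2z∉A u p∤u c+u∈B (subst (_∈ B) (cong ⟦_⟧ (eq₁ a S i j))
        (∈B _ (subst (p ∤_) (eq₂ a i j v) (p∤* _ v p∤ p∤v)) 2i∈))
        where
        eq₁ : ∀ a S i j → a ℤ.+ (+ 2 ℤ.* i ℤ.+ + 2 ℤ.* j ℤ.+ + 1) ℤ.* (+ 3 ℤ.* a ℤ.- + 2 ℤ.* S)
               ≡ + 2 ℤ.* (S ℤ.- (a ℤ.+ j ℤ.* (+ 3 ℤ.* a ℤ.- + 2 ℤ.* S))) ℤ.+
                 + 2 ℤ.* ((+ 2 ℤ.* j ℤ.+ i ℤ.+ + 1) ℤ.* (+ 3 ℤ.* a ℤ.- + 2 ℤ.* S))
        eq₁ = solve-∀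
        eq₂ : ∀ a i j v → (+ 2 ℤ.* i ℤ.+ j ℤ.+ + 1) ℤ.* v ≡
          a ℤ.+ (+ 2 ℤ.* i ℤ.+ + 2 ℤ.* j ℤ.+ + 1) ℤ.* v ℤ.- (a ℤ.+ j ℤ.* v)
        eq₂ = solve-∀

    -- Reflection takes index 0 to -1, then 1, then -3. Quadrupling about the centre belonging to j
    -- = 0 takes 1 to 7 and -3 to -9.
    -1∈ : N (ℤ.- + 1)
    -1∈ = reflect (+ 0) 0∈
    1∈ : N (+ 1)
    1∈ = reflect (ℤ.- + 1) -1∈
    -3∈ : N (ℤ.- + 3)
    -3∈ = reflect (+ 1) 1∈
    7∈ : N (+ 7)
    7∈ = quadruple (+ 0) (+ 1) 0∈ 1∈ (p∤≤6 (+ 1)) (p∤≤6 (+ 2))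
    -9∈ : N (ℤ.- + 9)
    -9∈ = quadruple (+ 0) (ℤ.- + 3) 0∈ -3∈ (p∤≤6 (ℤ.- + 3)) (p∤≤6 (ℤ.- + 2))

    impossible : ⊥
    -- For j = 7 and i = -9 the double has index 2i + 2j + 1 = -3, a known member. The side
    -- conditions are that -16, 6 and -10 are units.
    impossible = ¬double (+ 7) (ℤ.- + 9) 7∈ -9∈
      (p∤* (+ 4) (ℤ.- + 4) (p∤≤6 (+ 4)) (p∤≤6 (ℤ.- + 4))) (p∤≤6 (+ 6))
      (p∤* (+ 2) (ℤ.- + 5) (p∤≤6 (+ 2)) (p∤≤6 (ℤ.- + 5))) -3∈

  -- Upper bounds, reduced to sets of exact size.

  HasBarycentric-⊆ : ∀ {A A′} → A′ ⊆ A → HasBarycentric A′ → HasBarycentric A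
  HasBarycentric-⊆ A′⊆A (B , B⊆A′ , bary) = B , A′⊆A ∘ B⊆A′ , bary

  forces : ∀ l → (∀ {A} → Unique A → length A ≡ l → HasBarycentric A) → ForcesBarycentric k l
  forces l has A A! l≤|A| = HasBarycentric-⊆ take⊆ (has (Unique.take⁺ l A!)
    (trans (length-take l A) (ℕₚ.m≤n⇒m⊓n≡m l≤|A|)))
    where
    take⊆ : take l A ⊆ A
    take⊆ = subst (_ ∈_) (take++drop≡id l A) ∘ ∈-++⁺ˡ

  odd-order⇒forces : ∀ {t} → parity t ≡ 1ℙ → + p ∣ℤ + (2 ℕ.^ t) ℤ.- + 1 → ForcesBarycentric k (1 + k)
  odd-order⇒forces {t} t-odd 2^t≈1 = forces (1 + k) λ {A} A! |A| →
    fromInj₁ (λ free → contradiction free (odd-order⇒¬DoubleFree {t} t-odd 2^t≈1 _ A! |A|))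
      (HasBarycentric⊎DoubleFree (ι (sum A)) A! |A| (sym (⟦ι⟧ _)))

  forces-2+k : ForcesBarycentric k (2 + k)
  forces-2+k = forces (2 + k) has
    where
    has : ∀ {A} → Unique A → length A ≡ 2 + k → HasBarycentric A
    has {A} A! |A| = fromInj₁ (λ deletion →
      contradiction (λ z z∈A → resp z (deletion z∈A)) (¬all-deletions-DoubleFree S A! |A|))
      (∈-traverse A delete)
      where
      S = ι (sum A)

      Deletion : Fin p → Set
      Deletion a = ∃[ B ] (A ↭ a ∷ B × DoubleFree B (S ℤ.- ι a))

      delete : ∀ {a} → a ∈ A → HasBarycentric A ⊎ Deletion a
      delete {a} a∈A with B , A↭ ← ∈⇒↭ a∈A =
        Sum.map (HasBarycentric-⊆ (∈-resp-↭ (↭-sym A↭) ∘ there)) (λ free → B , A↭ , free)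
          (HasBarycentric⊎DoubleFree (S ℤ.- ι a) (tail (Unique-resp-↭ A↭ A!))
            (ℕₚ.suc-injective (trans (sym (↭-length A↭)) |A|))
            (sum-tail S (ι a) (sym (⟦ι⟧ _)) (subst (λ x → A ↭ x ∷ B) (sym (⟦ι⟧ a)) A↭)))

      -- `¬all-deletions-DoubleFree` quantifies over unreduced integers, because its progression a +
      -- jv is not reduced modulo p.
      resp : ∀ z → Deletion ⟦ z ⟧ → ∃[ B ] (A ↭ ⟦ z ⟧ ∷ B × DoubleFree B (S ℤ.- z))
      resp z (B , A↭ , free) = B , A↭ , DoubleFree-resp _ _
        (subst (+ p ∣ℤ_) (eq S z (ι ⟦ z ⟧)) (z≈ι⟦z⟧ z)) free
        where
        eq : ∀ S z z′ → z ℤ.- z′ ≡ S ℤ.- z′ ℤ.- (S ℤ.- z)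
        eq = solve-∀

  -- Lower bounds, and the set of nonzero squares.

  ¬HasBarycentric⇒length< : ∀ {A} → Unique A → ¬ HasBarycentric A →
                            ∀ m → ForcesBarycentric k m → 1 + length A ≤ m
  ¬HasBarycentric⇒length< {A} A! ¬has m forced = ℕₚ.≰⇒> λ m≤|A| → ¬has (forced A A! m≤|A|)

  squares : ℕ → List (Fin p)
  squares = applyDownFrom λ i → ⟦ + ℕ.suc i ℤ.* + ℕ.suc i ⟧

  -- The classical n(n + 1)(2n + 1)/6, kept free of division. At n = k the factor 2n + 1 is p, and 6
  -- is a unit, so the sum vanishes modulo p.
  squares-sum : ∀ n → ∃[ T ] (sum (squares n) ≡ ⟦ T ⟧ ×
                + 6 ℤ.* T ≡ (+ 1 ℤ.+ + 2 ℤ.* + n) ℤ.* (+ n ℤ.* (+ 1 ℤ.+ + n)))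
  squares-sum ℕ.zero    = + 0 , sym (⟦+⟧≡mod 0) , refl
  squares-sum (ℕ.suc n) with T , sum≡T , 6T≡ ← squares-sum n =
    + ℕ.suc n ℤ.* + ℕ.suc n ℤ.+ T ,
    trans (cong (⟦ + ℕ.suc n ℤ.* + ℕ.suc n ⟧ ⊕_) sum≡T) (⟦⟧-⊕ _ T) ,
    trans (eq₁ (+ ℕ.suc n) T) (trans (cong (ℤ._+_ (+ 6 ℤ.* (+ ℕ.suc n ℤ.* + ℕ.suc n))) 6T≡)
      (subst (λ m → + 6 ℤ.* (m ℤ.* m) ℤ.+ (+ 1 ℤ.+ + 2 ℤ.* + n) ℤ.* (+ n ℤ.* (+ 1 ℤ.+ + n))
                  ≡ (+ 1 ℤ.+ + 2 ℤ.* m) ℤ.* (m ℤ.* (+ 1 ℤ.+ m)))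
        (sym (ℤₚ.pos-+ 1 n)) (eq₂ (+ n))))
    where
    eq₁ : ∀ m T → + 6 ℤ.* (m ℤ.* m ℤ.+ T) ≡ + 6 ℤ.* (m ℤ.* m) ℤ.+ + 6 ℤ.* T
    eq₁ = solve-∀
    eq₂ : ∀ n → + 6 ℤ.* ((+ 1 ℤ.+ n) ℤ.* (+ 1 ℤ.+ n)) ℤ.+ (+ 1 ℤ.+ + 2 ℤ.* n) ℤ.* (n ℤ.* (+ 1 ℤ.+ n))
              ≡ (+ 1 ℤ.+ + 2 ℤ.* (+ 1 ℤ.+ n)) ℤ.* ((+ 1 ℤ.+ n) ℤ.* (+ 1 ℤ.+ (+ 1 ℤ.+ n)))
    eq₂ = solve-∀

  sum[squares]≡0 : sum (squares k) ≡ ⟦ + 0 ⟧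
  sum[squares]≡0 with T , sum≡T , 6T≡ ← squares-sum k =
    trans sum≡T (decidable-stable (_ Fin.≟ _) λ T≢0 →
      p∤* (+ 6) (T ℤ.- + 0) (p∤≤6 (+ 6)) (T≢0 ∘ ≈⇒≡ T (+ 0))
        (subst (+ p ∣ℤ_) (trans (sym 6T≡) (cong (+ 6 ℤ.*_) (sym (ℤₚ.+-identityʳ T)))) (p∣1+2K* _)))

  k<p : k ℕ.< p
  k<p = subst (k ℕ.<_) (sym p≡1+2k) (ℕ.s≤s (ℕₚ.m≤m+n k _))

  -- If x² = y² modulo p with 1 ≤ y < x ≤ k, then p divides (x - y)(x + y), but both factors lie
  -- strictly between 0 and p.
  squares! : Unique (squares k)
  squares! = Unique.applyDownFrom⁺₁ _ k λ {i} {j} j<i i<k eqn →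
    let j<k = ℕₚ.<-trans j<i i<k
        sum≡ : + (ℕ.suc i + ℕ.suc j) ≡ + ℕ.suc i ℤ.+ + ℕ.suc j
        sum≡ = ℤₚ.pos-+ (ℕ.suc i) (ℕ.suc j)
        diff≡ : + (i ∸ j) ≡ + ℕ.suc i ℤ.- + ℕ.suc j
        diff≡ = sym (trans (ℤₚ.m-n≡m⊖n (ℕ.suc i) (ℕ.suc j)) (ℤₚ.⊖-≥ (ℕ.s≤s (ℕₚ.<⇒≤ j<i))))
    in p∤* _ _
         (subst (p ∤_) diff≡ (p∤small _ {{ℕ.>-nonZero (ℕₚ.m<n⇒0<n∸m j<i)}}
           (ℕₚ.≤-<-trans (ℕₚ.m∸n≤m i j) (ℕₚ.<-trans i<k k<p))))
         (subst (p ∤_) sum≡ (p∤small _ (subst (ℕ.suc i + ℕ.suc j ℕ.<_) (sym p≡1+2k)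
           (ℕ.s≤s (ℕₚ.+-mono-≤ i<k (ℕₚ.≤-trans j<k (ℕₚ.m≤m+n k 0)))))))
         (subst (+ p ∣ℤ_) (eq (+ ℕ.suc i) (+ ℕ.suc j)) (≡⇒≈ _ _ eqn))
    where
    eq : ∀ x y → x ℤ.* x ℤ.- y ℤ.* y ≡ (x ℤ.- y) ℤ.* (x ℤ.+ y)
    eq = solve-∀

  0∉squares : ⟦ + 0 ⟧ ∉ squares k
  0∉squares 0∈ with i , i<k , eqn ← ∈-applyDownFrom⁻ _ 0∈ =
    p∤* (+ ℕ.suc i) (+ ℕ.suc i) p∤i p∤i
      (subst (+ p ∣ℤ_) (ℤₚ.+-identityʳ _) (≡⇒≈ _ (+ 0) (sym eqn)))
    where
    p∤i = p∤small (+ ℕ.suc i) (ℕₚ.≤-<-trans i<k k<p)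

  -- The only k-subset is the whole set; its sum is 0, so its barycentre would be 0.
  squares-¬HasBarycentric : ¬ HasBarycentric (squares k)
  squares-¬HasBarycentric (B , B⊆ , B! , |B| , g , g∈B , sumB) =
    0∉squares (B⊆ (subst (_∈ B) (k·≡T⇒-2T (+ 0) g (trans (sym sum≡0) sumB)) g∈B))
    where
    sum≡0 : sum B ≡ ⟦ + 0 ⟧
    sum≡0 = trans (sym (sum-resp-↭ (Unique-⊆-length⇒↭ B! B⊆
      (trans |B| (sym (length-applyDownFrom _ k)))))) sum[squares]≡0

  forced⇒1+k≤ : ∀ m → ForcesBarycentric k m → 1 + k ≤ m
  forced⇒1+k≤ m forced = subst (λ l → 1 + l ≤ m) (length-applyDownFrom _ k)
    (¬HasBarycentric⇒length< squares! squares-¬HasBarycentric m forced)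

  -- Even order: a double-free (k+1)-set with sum 0.

  module EvenOrder (t : ℕ) .{{_ : NonZero t}} (t-even : parity t ≡ 0ℙ)
                   (2^t≈1 : + p ∣ℤ + (2 ℕ.^ t) ℤ.- + 1)
                   (t-minimal : ∀ s → 0 ℕ.< s → + p ∣ℤ + (2 ℕ.^ s) ℤ.- + 1 → t ≤ s) where

    2^+ : ∀ m n → + (2 ℕ.^ (m + n)) ≡ + (2 ℕ.^ m) ℤ.* + (2 ℕ.^ n)
    2^+ m n = trans (cong +_ (ℕₚ.^-distribˡ-+-* 2 m n)) (ℤₚ.pos-* (2 ℕ.^ m) (2 ℕ.^ n))

    2^-shift : ∀ m {n} → + p ∣ℤ + (2 ℕ.^ n) ℤ.- + 1 → + p ∣ℤ + (2 ℕ.^ (m + n)) ℤ.- + (2 ℕ.^ m)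
    2^-shift m {n} 2^n≈1 = subst (+ p ∣ℤ_)
      (trans (eq (+ (2 ℕ.^ m)) (+ (2 ℕ.^ n))) (cong (λ q → q ℤ.- + (2 ℕ.^ m)) (sym (2^+ m n))))
      (ℤ∣.∣n⇒∣m*n (+ (2 ℕ.^ m)) 2^n≈1)
      where
      eq : ∀ x y → x ℤ.* (y ℤ.- + 1) ≡ x ℤ.* y ℤ.- x
      eq = solve-∀

    2^[q*t]≈1 : ∀ q → + p ∣ℤ + (2 ℕ.^ (q ℕ.* t)) ℤ.- + 1
    2^[q*t]≈1 ℕ.zero    = divides (+ 0) refl
    2^[q*t]≈1 (ℕ.suc q) = subst (+ p ∣ℤ_) (eq (+ (2 ℕ.^ (t + q ℕ.* t))) (+ (2 ℕ.^ t)))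
      (ℤ∣.∣m∣n⇒∣m+n (2^-shift t (2^[q*t]≈1 q)) 2^t≈1)
      where
      eq : ∀ x y → x ℤ.- y ℤ.+ (y ℤ.- + 1) ≡ x ℤ.- + 1
      eq = solve-∀

    2^-% : ∀ n → + p ∣ℤ + (2 ℕ.^ n) ℤ.- + (2 ℕ.^ (n ℕ.% t))
    2^-% n = subst (λ m → + p ∣ℤ + (2 ℕ.^ m) ℤ.- + (2 ℕ.^ (n ℕ.% t))) (sym (ℕ.m≡m%n+[m/n]*n n t))
      (2^-shift (n ℕ.% t) (2^[q*t]≈1 (n / t)))

    -- Minimality of t forces the remainder of n modulo t to be 0, so n is a multiple of the even
    -- number t.
    2^n≈1⇒even : ∀ n → + p ∣ℤ + (2 ℕ.^ n) ℤ.- + 1 → parity n ≡ 0ℙ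
    2^n≈1⇒even n 2^n≈1 with n ℕ.% t | ℕ.m≡m%n+[m/n]*n n t | ℕ.m%n<n n t | 2^-% n
    ... | ℕ.zero  | n≡ | _   | _       = trans (cong parity n≡)
          (trans (ℙ.*-homo-* (n / t) t) (trans (cong (parity (n / t) ℙ.*_) t-even) (ℙ.*-zeroʳ (parity (n / t)))))
    ... | ℕ.suc r | n≡ | r<t | 2^n≈2^r = contradiction (t-minimal (ℕ.suc r) (ℕ.s≤s ℕ.z≤n)
          (subst (+ p ∣ℤ_) (eq (+ (2 ℕ.^ n)) (+ (2 ℕ.^ ℕ.suc r))) (ℤ∣.∣m∣n⇒∣m-n 2^n≈1 2^n≈2^r))) (ℕₚ.<⇒≱ r<t)
      where
      eq : ∀ x y → x ℤ.- + 1 ℤ.- (x ℤ.- y) ≡ y ℤ.- + 1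
      eq = solve-∀

    2^-parity-≤ : ∀ {m n} → m ≤ n → + p ∣ℤ + (2 ℕ.^ n) ℤ.- + (2 ℕ.^ m) → parity m ≡ parity n
    2^-parity-≤ {m} m≤n p∣ with d , refl ← ℕₚ.m≤n⇒∃[o]m+o≡n m≤n =
      sym (trans (ℙ.+-homo-+ m d) (trans (cong (parity m ℙ.+_) (2^n≈1⇒even d 2^d≈1)) (ℙ.+-identityʳ (parity m))))
      where
      eq : ∀ x y → x ℤ.* y ℤ.- x ≡ x ℤ.* (y ℤ.- + 1)
      eq = solve-∀
      2^d≈1 : + p ∣ℤ + (2 ℕ.^ d) ℤ.- + 1
      2^d≈1 = p∣*⇒p∣ʳ _ _ (p∤2^ m) (subst (+ p ∣ℤ_)
        (trans (cong (λ q → q ℤ.- + (2 ℕ.^ m)) (2^+ m d)) (eq (+ (2 ℕ.^ m)) (+ (2 ℕ.^ d)))) p∣)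

    -- Even order makes the parity of an exponent depend only on the power of 2 modulo p.
    2^-parity : ∀ m n → + p ∣ℤ + (2 ℕ.^ m) ℤ.- + (2 ℕ.^ n) → parity m ≡ parity n
    2^-parity m n p∣ with ℕₚ.≤-total m n
    ... | inj₁ m≤n = 2^-parity-≤ m≤n (subst (+ p ∣ℤ_) (eq (+ (2 ℕ.^ m)) (+ (2 ℕ.^ n))) (ℤ∣.∣m⇒∣-m p∣))
      where
      eq : ∀ x y → ℤ.- (x ℤ.- y) ≡ y ℤ.- x
      eq = solve-∀
    ... | inj₂ n≤m = sym (2^-parity-≤ n≤m p∣)

    orbit : Fin p → ℕ → Fin p
    orbit x i = ⟦ + (2 ℕ.^ i) ℤ.* ι x ⟧

    double : Fin p → Fin p
    double x = ⟦ + 2 ℤ.* ι x ⟧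

    orbit-double : ∀ x i → orbit (double x) i ≡ orbit x (ℕ.suc i)
    orbit-double x i = sym (trans (cong (λ q → ⟦ q ℤ.* ι x ⟧) (2^suc i)) (≈⇒≡ _ _ (subst (+ p ∣ℤ_)
      (eq (+ (2 ℕ.^ i)) (ι x) (ι (double x))) (ℤ∣.∣n⇒∣m*n (+ (2 ℕ.^ i)) (z≈ι⟦z⟧ (+ 2 ℤ.* ι x))))))
      where
      eq : ∀ q x y → q ℤ.* (+ 2 ℤ.* x ℤ.- y) ≡ + 2 ℤ.* q ℤ.* x ℤ.- q ℤ.* y
      eq = solve-∀

    orbit-% : ∀ x i → orbit x i ≡ orbit x (i ℕ.% t)
    orbit-% x i = ≈⇒≡ _ _ (subst (+ p ∣ℤ_) (eq (+ (2 ℕ.^ i)) (+ (2 ℕ.^ (i ℕ.% t))) (ι x))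
      (ℤ∣.∣m⇒∣m*n (ι x) (2^-% i)))
      where
      eq : ∀ q r x → (q ℤ.- r) ℤ.* x ≡ q ℤ.* x ℤ.- r ℤ.* x
      eq = solve-∀

    -- The least residue serves as canonical representative of each orbit under doubling, and `μ x`
    -- counts doublings from x to it. Only the parity of this count is used afterwards.
    μ : Fin p → ℕ
    -- The default 0 lies in `upTo t`, as t is positive.
    μ x = argmin (toℕ ∘ orbit x) 0 (upTo t)

    μ-minimal : ∀ x i → toℕ (orbit x (μ x)) ≤ toℕ (orbit x i)
    μ-minimal x i = subst (λ y → toℕ (orbit x (μ x)) ≤ toℕ y) (sym (orbit-% x i))
      (All.lookup (f[argmin]≤f[xs] {f = toℕ ∘ orbit x} 0 (upTo t)) (∈-upTo⁺ (ℕ.m%n<n i t)))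

    opaque
      nonZeros : ∃[ xs ] allFin p ↭ ⟦ + 0 ⟧ ∷ xs
      nonZeros = ∈⇒↭ (∈-allFin ⟦ + 0 ⟧)

    0∷nonZeros! : Unique (⟦ + 0 ⟧ ∷ proj₁ nonZeros)
    0∷nonZeros! = Unique-resp-↭ (proj₂ nonZeros) (Unique.allFin⁺ p)

    ∈-nonZeros⁺ : ∀ {x} → x ≢ ⟦ + 0 ⟧ → x ∈ proj₁ nonZeros
    ∈-nonZeros⁺ {x} = ∈-tail (∈-resp-↭ (proj₂ nonZeros) (∈-allFin x))

    ∈-nonZeros⁻ : ∀ {x} → x ∈ proj₁ nonZeros → x ≢ ⟦ + 0 ⟧
    ∈-nonZeros⁻ = ∉∧∈⇒≢ (head∉tail 0∷nonZeros!)

    ι-p∤ : ∀ {x} → x ≢ ⟦ + 0 ⟧ → p ∤ ι x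
    ι-p∤ {x} x≢0 p∣ = x≢0 (trans (sym (⟦ι⟧ x)) (≈⇒≡ (ι x) (+ 0) (subst (+ p ∣ℤ_) (sym (ℤₚ.+-identityʳ _)) p∣)))

    -- Multiplying by 2 moves the least element of the orbit back by one step.
    μ-double : ∀ x → x ≢ ⟦ + 0 ⟧ → parity (ℕ.suc (μ (double x))) ≡ parity (μ x)
    μ-double x x≢0 = 2^-parity (ℕ.suc (μ (double x))) (μ x) (p∣*⇒p∣ʳ (ι x) _ (ι-p∤ x≢0) (subst (+ p ∣ℤ_)
      (eq (+ (2 ℕ.^ ℕ.suc (μ (double x)))) (+ (2 ℕ.^ μ x)) (ι x)) (≡⇒≈ _ _ orbits≡)))
      where
      eq : ∀ q r x → q ℤ.* x ℤ.- r ℤ.* x ≡ x ℤ.* (q ℤ.- r)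
      eq = solve-∀
      -- From 2x a further t - 1 doublings return to x, so the orbit of 2x also reaches the minimum
      -- found from x.
      orbit-back : orbit (double x) (ℕ.pred t + μ x) ≡ orbit x (μ x)
      orbit-back = trans (orbit-double x (ℕ.pred t + μ x)) (trans (cong (λ s → orbit x (s + μ x)) (ℕₚ.suc-pred t))
        (trans (orbit-% x (t + μ x)) (trans (cong (orbit x)
          (trans (cong (ℕ._% t) (ℕₚ.+-comm t (μ x))) (ℕ.[m+n]%n≡m%n (μ x) t))) (sym (orbit-% x (μ x))))))
      orbits≡ : orbit x (ℕ.suc (μ (double x))) ≡ orbit x (μ x)
      orbits≡ = Fin.toℕ-injective (ℕₚ.≤-antisym
        (subst (_≤ toℕ (orbit x (μ x))) (cong toℕ (orbit-double x (μ (double x))))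
          (subst (λ y → toℕ (orbit (double x) (μ (double x))) ≤ toℕ y) orbit-back
            (μ-minimal (double x) (ℕ.pred t + μ x))))
        (μ-minimal x (ℕ.suc (μ (double x)))))

    class : Parity → List (Fin p)
    class q = filter (λ x → parity (μ x) ℙ.≟ q) (proj₁ nonZeros)

    class! : ∀ q → Unique (class q)
    class! q = Unique.filter⁺ _ (tail 0∷nonZeros!)

    ∈-class⁺ : ∀ q {x} → x ≢ ⟦ + 0 ⟧ → parity (μ x) ≡ q → x ∈ class q
    ∈-class⁺ q x≢0 = ∈-filter⁺ (λ x → parity (μ x) ℙ.≟ q) (∈-nonZeros⁺ x≢0)

    ∈-class⁻ : ∀ q {x} → x ∈ class q → x ≢ ⟦ + 0 ⟧ × parity (μ x) ≡ q
    ∈-class⁻ q x∈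
      with x∈nz , χx≡q ← ∈-filter⁻ (λ x → parity (μ x) ℙ.≟ q) {xs = proj₁ nonZeros} x∈
      = ∈-nonZeros⁻ x∈nz , χx≡q

    0∉class : ∀ q → ⟦ + 0 ⟧ ∉ class q
    0∉class q 0∈ = proj₁ (∈-class⁻ q 0∈) refl

    double-injective : ∀ {x y} → double x ≡ double y → x ≡ y
    double-injective {x} {y} eqn =
      trans (sym (⟦ι⟧ x)) (trans (2*-injective (ι x) (ι y) (≡⇒≈ _ _ eqn)) (⟦ι⟧ y))

    double≢0 : ∀ {x} → x ≢ ⟦ + 0 ⟧ → double x ≢ ⟦ + 0 ⟧
    double≢0 {x} x≢0 eqn = p∤* (+ 2) (ι x) (p∤≤6 (+ 2)) (ι-p∤ x≢0)
      (subst (+ p ∣ℤ_) (ℤₚ.+-identityʳ _) (≡⇒≈ _ (+ 0) eqn))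

    double∈class : ∀ q {x} → x ∈ class q → double x ∈ class (q ⁻¹)
    double∈class q {x} x∈ with x≢0 , χx≡q ← ∈-class⁻ q x∈ = ∈-class⁺ (q ⁻¹) (double≢0 x≢0)
      (trans (sym (ℙ.suc-homo-⁻¹ (μ (double x)))) (cong _⁻¹ (trans (μ-double x x≢0) χx≡q)))

    map-double! : ∀ {xs} → Unique xs → Unique (map double xs)
    map-double! = Unique.map⁺ double-injective

    map-double⊆ : ∀ q {xs} → xs ⊆ class q → map double xs ⊆ class (q ⁻¹)
    map-double⊆ q {xs} xs⊆ y∈ with x , x∈xs , refl ← ∈-map⁻ double y∈ = double∈class q (xs⊆ x∈xs)

    -- Doubling injects each class into the other. Used both ways, this splits the 2k nonzero
    -- residues into halves of size k.
    |class|≤ : ∀ q → length (class q) ≤ length (class (q ⁻¹))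
    |class|≤ q = subst (_≤ length (class (q ⁻¹))) (length-map double (class q))
      (Unique-⊆⇒length≤ (map-double! (class! q)) (map-double⊆ q id))

    |class| : length (class 0ℙ) ≡ k
    |class| = ℕₚ.*-cancelˡ-≡ _ k 2 (begin
      2 ℕ.* length (class 0ℙ)                    ≡⟨ cong (ℕ._+_ (length (class 0ℙ))) (ℕₚ.+-identityʳ _) ⟩
      length (class 0ℙ) + length (class 0ℙ)      ≡⟨ cong (ℕ._+_ (length (class 0ℙ))) (ℕₚ.≤-antisym (|class|≤ 0ℙ) (|class|≤ 1ℙ)) ⟩
      length (class 0ℙ) + length (class 1ℙ)      ≡⟨ length-filter-parity (parity ∘ μ) (proj₁ nonZeros) ⟩
      length (proj₁ nonZeros)                    ≡⟨ ℕₚ.suc-injective (begin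
        1 + length (proj₁ nonZeros)                ≡⟨ ↭-length (proj₂ nonZeros) ⟨
        length (allFin p)                          ≡⟨ length-tabulate id ⟩
        p                                          ≡⟨ p≡1+2k ⟩
        1 + 2 ℕ.* k                                ∎) ⟩
      2 ℕ.* k                                    ∎)
      where open ≡-Reasoning

    sum-map-double : ∀ xs s → sum xs ≡ ⟦ s ⟧ → sum (map double xs) ≡ ⟦ + 2 ℤ.* s ⟧
    sum-map-double xs s sum≡s = trans (go xs) (≈⇒≡ _ _ (subst (+ p ∣ℤ_) (eq (ι (sum xs)) s)
      (ℤ∣.∣n⇒∣m*n (+ 2) (≡⇒≈ _ s (trans (⟦ι⟧ _) sum≡s)))))
      where
      eq : ∀ x s → + 2 ℤ.* (x ℤ.- s) ≡ + 2 ℤ.* x ℤ.- + 2 ℤ.* s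
      eq = solve-∀
      eq′ : ∀ x y z → + 2 ℤ.* (x ℤ.+ y ℤ.- z) ≡ + 2 ℤ.* x ℤ.+ + 2 ℤ.* y ℤ.- + 2 ℤ.* z
      eq′ = solve-∀
      go : ∀ xs → sum (map double xs) ≡ double (sum xs)
      go []       = trans (sym (⟦+⟧≡mod 0)) (≈⇒≡ (+ 0) _ (subst (+ p ∣ℤ_) (eq₀ (ι (0 ℕ.mod p)))
        (ℤ∣.∣n⇒∣m*n (+ 2) (≡⇒≈ (+ 0) _ (trans (⟦+⟧≡mod 0) (sym (⟦ι⟧ _)))))))
        where
        eq₀ : ∀ x → + 2 ℤ.* (+ 0 ℤ.- x) ≡ + 0 ℤ.- + 2 ℤ.* x
        eq₀ = solve-∀
      go (x ∷ xs) = trans (cong (double x ⊕_) (go xs)) (trans (⟦⟧-⊕ _ _)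
        (≈⇒≡ _ _ (subst (+ p ∣ℤ_) (eq′ (ι x) (ι (sum xs)) (ι (x ⊕ sum xs)))
          (ℤ∣.∣n⇒∣m*n (+ 2) (≡⇒≈ _ _ (trans (sym (⟦⟧-⊕ _ _))
            (trans (cong₂ _⊕_ (⟦ι⟧ x) (⟦ι⟧ (sum xs))) (sym (⟦ι⟧ _)))))))))

    -- Multiplication by 4 permutes the class, and 4 - 1 is a unit.
    sum[class]≡0 : sum (class 0ℙ) ≡ ⟦ + 0 ⟧
    sum[class]≡0 = trans (sym (⟦ι⟧ _)) (decidable-stable (_ Fin.≟ _) λ s≢0 →
      p∤* (+ 3) (s ℤ.- + 0) (p∤≤6 (+ 3)) (s≢0 ∘ ≈⇒≡ s (+ 0))
        (subst (+ p ∣ℤ_) (eq s) (≡⇒≈ (+ 2 ℤ.* (+ 2 ℤ.* s)) s (trans (sym sum4D)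
          (trans (sym (sum-resp-↭ D↭4D)) (sym (⟦ι⟧ _)))))))
      where
      D = class 0ℙ
      s = ι (sum D)
      sum4D = sum-map-double (map double D) (+ 2 ℤ.* s) (sum-map-double D s (sym (⟦ι⟧ _)))
      D↭4D : D ↭ map double (map double D)
      D↭4D = Unique-⊆-length⇒↭ (map-double! (map-double! (class! 0ℙ)))
        (map-double⊆ 1ℙ (map-double⊆ 0ℙ id)) (trans (length-map double (map double D)) (length-map double D))
      eq : ∀ s → + 2 ℤ.* (+ 2 ℤ.* s) ℤ.- s ≡ + 3 ℤ.* (s ℤ.- + 0)
      eq = solve-∀

    double-⟦⟧ : ∀ z → ⟦ + 2 ℤ.* (z ℤ.- + 0) ⟧ ≡ double ⟦ z ⟧
    double-⟦⟧ z = ≈⇒≡ _ _ (subst (+ p ∣ℤ_) (eq z (ι ⟦ z ⟧)) (ℤ∣.∣n⇒∣m*n (+ 2) (z≈ι⟦z⟧ z)))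
      where
      eq : ∀ z z′ → + 2 ℤ.* (z ℤ.- z′) ≡ + 2 ℤ.* (z ℤ.- + 0) ℤ.- + 2 ℤ.* z′
      eq = solve-∀

    -- The sum is 0, so the centre is 0, which doubling fixes; every other element is sent by
    -- doubling into the opposite class.
    0∷class-DoubleFree : DoubleFree (⟦ + 0 ⟧ ∷ class 0ℙ) (+ 0)
    0∷class-DoubleFree z (here z≡0) _ = ≈⇒≡ _ _ (subst (+ p ∣ℤ_) (eq z) (≡⇒≈ z (+ 0) z≡0))
      where
      eq : ∀ z → z ℤ.- + 0 ≡ + 2 ℤ.* (z ℤ.- + 0) ℤ.- z
      eq = solve-∀
    0∷class-DoubleFree z (there z∈) (here 2z≡0) = contradiction (trans (sym (double-⟦⟧ z)) 2z≡0)
      (double≢0 (proj₁ (∈-class⁻ 0ℙ z∈)))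
    0∷class-DoubleFree z (there z∈) (there 2z∈) = contradiction
      (trans (sym (proj₂ (∈-class⁻ 1ℙ (double∈class 0ℙ z∈))))
             (proj₂ (∈-class⁻ 0ℙ (subst (_∈ class 0ℙ) (double-⟦⟧ z) 2z∈))))
      λ ()

    forced⇒2+k≤ : ∀ m → ForcesBarycentric k m → 2 + k ≤ m
    forced⇒2+k≤ m forced = subst (λ l → 2 + l ≤ m) |class| (¬HasBarycentric⇒length< A!
      (DoubleFree⇒¬HasBarycentric (+ 0) A! (cong ℕ.suc |class|) sumA 0∷class-DoubleFree) m forced)
      where
      A! : Unique (⟦ + 0 ⟧ ∷ class 0ℙ)
      A! = ¬Any⇒All¬ _ (0∉class 0ℙ) ∷ class! 0ℙ
      sumA : sum (⟦ + 0 ⟧ ∷ class 0ℙ) ≡ ⟦ + 0 ⟧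
      sumA = trans (cong (⟦ + 0 ⟧ ⊕_) sum[class]≡0) (⟦⟧-⊕ (+ 0) (+ 0))

-- Oddness of p, and the two cases put together.

prime⇒≡1+2* : ∀ {p} → Prime p → 7 ≤ p → p ≡ 1 + 2 ℕ.* ((p ∸ 1) / 2)
prime⇒≡1+2* {ℕ.suc n} p-prime 7≤p
  with n ℕ.% 2 | ℕ.m≡m%n+[m/n]*n n 2 | ℕ.m%n<n n 2
... | 0 | n≡ | _ = cong ℕ.suc (trans n≡ (ℕₚ.*-comm (n / 2) 2))
... | ℕ.suc (ℕ.suc _) | _ | ℕ.s≤s (ℕ.s≤s ())
-- An odd p - 1 would make 2 a divisor of the prime p, hence p = 2.
... | 1 | n≡ | _ with prime⇒irreducible p-prime (ℕ∣.divides (ℕ.suc (n / 2)) (cong ℕ.suc n≡))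
...   | inj₂ refl = contradiction 7≤p λ { (ℕ.s≤s (ℕ.s≤s ())) }

mainTheorem7 : ∀ (p : ℕ) → .{{_ : NonZero p}} → Prime p → 7 ≤ p →
    let k = (p ∸ 1) / 2 in
    ∀ (t : ℕ) → IsMultiplicativeOrder 2 p t →
    (parity t ≡ 1ℙ → IsBO (ℤ/ p) k (k + 1)) ×
    (parity t ≡ 0ℙ → IsBO (ℤ/ p) k (k + 2))
mainTheorem7 p p-prime 7≤p t ((0<t , 2^t%p≡1) , t-minimal) =
  (λ t-odd → subst (IsBO (ℤ/ p) k) (ℕₚ.+-comm 1 k)
    (odd-order⇒forces {t} t-odd (%⇒≈ t 2^t%p≡1) , forced⇒1+k≤)) ,
  (λ t-even → subst (IsBO (ℤ/ p) k) (ℕₚ.+-comm 2 k)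
    (forces-2+k , EvenOrder.forced⇒2+k≤ t {{ℕ.>-nonZero 0<t}} t-even (%⇒≈ t 2^t%p≡1)
      λ s 0<s 2^s≈1 → t-minimal s (0<s , ≈⇒% s 2^s≈1)))
  where
  k = (p ∸ 1) / 2
  open Residues p
  open OddModulus p k p-prime 7≤p (prime⇒≡1+2* p-prime 7≤p)
  %⇒≈ : ∀ n → (2 ℕ.^ n) ℕ.% p ≡ 1 ℕ.% p → + p ∣ℤ + (2 ℕ.^ n) ℤ.- + 1
  %⇒≈ n eqn = ≡⇒≈ (+ (2 ℕ.^ n)) (+ 1)
    (Fin.toℕ-injective (trans (toℕ-⟦⟧ _) (trans eqn (sym (toℕ-⟦⟧ (+ 1))))))
  ≈⇒% : ∀ n → + p ∣ℤ + (2 ℕ.^ n) ℤ.- + 1 → (2 ℕ.^ n) ℕ.% p ≡ 1 ℕ.% p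
  ≈⇒% n p∣ = trans (sym (toℕ-⟦⟧ (+ (2 ℕ.^ n)))) (trans (cong toℕ (≈⇒≡ (+ (2 ℕ.^ n)) (+ 1) p∣)) (toℕ-⟦⟧ (+ 1)))
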